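{- For $m\ge 2$, $sn(f_m)=m$, where $f_m$ is the friendship graph.
   Context: Graphs are finite, undirected and simple. The friendship graph $f_m$, $m\ge 2$, is the graph obtained from $m$ disjoint triangles $K_3$ by choosing one vertex in each and identifying these $m$ vertices into a single common vertex (so it has $2m+1$ vertices). Let $G=(V,E)$ be a connected graph with chromatic number $\chi(G)=k\ge 2$. For $S\subset V$, a partial coloring on $G[S]$ is a proper coloring $\mathscr C_0$ of the induced subgraph $G[S]$ with colors from $\{1,\dots,k\}$ (not all colors need be used). It is a Sudoku coloring of $G$ if there is exactly one proper $k$-coloring $V\to\{1,\dots,k\}$ of $G$ whose restriction to $S$ is $\mathscr C_0$. The Sudoku number $sn(G)$ is the smallest $|S|$ such that $G[S]$ admits a Sudoku coloring of $G$. -}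

module Defs where

open import Data.Fin using (Fin; zero; suc; combine)
open import Data.Fin.Properties using (_≟_; any?; combine-injectiveʳ; suc-injective)
open import Data.Fin.Subset using (Subset; _∈_; ∣_∣)
open import Data.Nat using (ℕ; suc; _*_; _≤_)
open import Data.Product using (∃; ∃!; ∃-syntax; _×_; _,_; proj₁)
open import Function using (_on_; _∘_)
open import Relation.Binary.Construct.Closure.ReflexiveTransitive using (Star)
open import Relation.Binary.Core using (Rel)
open import Relation.Binary.Definitions using (Decidable; Irreflexive; Symmetric)
open import Relation.Binary.PropositionalEquality using (_≡_; _≢_; _≗_; refl; sym; trans; cong)
open import Relation.Nullary.Decidable using (_×-dec_; ¬?)
open import Level using (0ℓ)

record Graph : Set₁ where
  field
    order : ℕ
  Vertex : Set
  Vertex = Fin order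
  field
    Adj    : Rel Vertex 0ℓ
    adj?   : Decidable Adj
    irrefl : Irreflexive _≡_ Adj
    symm   : Symmetric Adj

Connected : Graph → Set
Connected G = ∀ (u v : Vertex) → Star Adj u v
  where open Graph G

-- Colour sets {1,…,k} are represented by Fin k.  The vertex type is arbitrary
-- so that the notion applies to a graph as well as to an induced subgraph.
Proper : ∀ {V : Set} {k : ℕ} → Rel V 0ℓ → (V → Fin k) → Set
Proper R c = ∀ {u v} → R u v → c u ≢ c v

Least : (ℕ → Set) → ℕ → Set
Least P n = P n × (∀ {j} → P j → n ≤ j)

Colorable : Graph → ℕ → Set
Colorable G k = ∃[ c ] Proper {Vertex} {k} Adj c
  where open Graph G

IsChromaticNumber : Graph → ℕ → Set
IsChromaticNumber G = Least (Colorable G)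

module _ (G : Graph) where
  open Graph G

  InducedVertex : Subset order → Set
  InducedVertex S = ∃[ v ] v ∈ S

  inducedAdj : (S : Subset order) → Rel (InducedVertex S) 0ℓ
  inducedAdj S = Adj on proj₁

  IsPartialColoring : (k : ℕ) (S : Subset order) → (InducedVertex S → Fin k) → Set
  IsPartialColoring k S c₀ = Proper (inducedAdj S) c₀

  -- Colourings are functions, so "exactly one" is up to pointwise equality.
  IsSudokuColoring : (k : ℕ) (S : Subset order) → (InducedVertex S → Fin k) → Set
  IsSudokuColoring k S c₀ =
    IsPartialColoring k S c₀ ×
    ∃! _≗_ (λ (c : Vertex → Fin k) → Proper Adj c × (c ∘ proj₁) ≗ c₀)

  AdmitsSudokuColoring : ℕ → Subset order → Set
  AdmitsSudokuColoring k S = ∃[ c₀ ] IsSudokuColoring k S c₀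

-- The relation sn(G) = s.  The Sudoku number is only defined for connected
-- graphs with chromatic number at least 2, so these conditions are part of it.
record IsSudokuNumber (G : Graph) (s : ℕ) : Set where
  open Graph G
  field
    connected : Connected G
    k         : ℕ
    chromatic : IsChromaticNumber G k
    2≤k       : 2 ≤ k
    least     : Least (λ j → ∃[ S ] (∣ S ∣ ≡ j × AdmitsSudokuColoring G k S)) s

module _ (m : ℕ) where

  -- The identification map from the m disjoint triangles, with vertices
  -- (t , a) in Fin m × Fin 3: exactly the corners (t , 0) are glued together.
  glue : Fin m → Fin 3 → Fin (suc (m * 2))
  glue t zero    = zero
  glue t (suc a) = suc (combine t a)

  FriendshipAdj : Rel (Fin (suc (m * 2))) 0ℓ
  FriendshipAdj u v = ∃[ t ] ∃[ a ] ∃[ b ] (a ≢ b × u ≡ glue t a × v ≡ glue t b)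

  glue-injective : ∀ t a b → glue t a ≡ glue t b → a ≡ b
  glue-injective t zero    zero    _  = refl
  glue-injective t (suc a) (suc b) eq =
    cong suc (combine-injectiveʳ t a t b (suc-injective eq))

  friendship : Graph
  friendship = record
    { order  = suc (m * 2)
    ; Adj    = FriendshipAdj
    ; adj?   = λ u v → any? λ t → any? λ a → any? λ b →
                 ¬? (a ≟ b) ×-dec (u ≟ glue t a) ×-dec (v ≟ glue t b)
    ; irrefl = λ { refl (t , a , b , a≢b , p , q) →
                     a≢b (glue-injective t a b (trans (sym p) q)) }
    ; symm   = λ { (t , a , b , a≢b , p , q) → t , b , a , a≢b ∘ sym , q , p }
    }

{-# OPTIONS --safe #-}
-- Exchanging the two outer vertices of one triangle is an automorphism, so a
-- partial colouring with a unique extension must colour an outer vertex of each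
-- of the m triangles.  Conversely, with one outer vertex coloured per triangle
-- and both of two colours occurring, the centre is forced to take the third
-- colour, and then so is every remaining vertex.
module Submission where

open import Defs
open import Data.Bool using (if_then_else_)
open import Data.Fin using (Fin; zero; suc; combine; remQuot)
open import Data.Fin.Patterns using (0F; 1F; 2F)
open import Data.Fin.Properties
  using (_≟_; all?; remQuot-combine; combine-remQuot; injective⇒≤)
open import Data.Fin.Subset using (Subset; _∈_; ∣_∣; inside; outside)
open import Data.Fin.Subset.Properties using (_∈?_; drop-there)
open import Data.Nat using (ℕ; zero; suc; _*_; _≤_; z≤n; s≤s)
open import Data.Nat.Properties using (≤-trans; n≤1+n)
open import Data.Product using (∃-syntax; _,_; proj₁; uncurry)
open import Data.Vec using ([]; _∷_; concat; replicate; here; there)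
open import Function using (id; _∘_)
open import Function.Definitions using (Injective)
open import Relation.Binary.Construct.Closure.ReflexiveTransitive
  using (Star; ε; _◅_; _◅◅_; reverse)
open import Relation.Binary.PropositionalEquality
open import Relation.Nullary using (¬_; yes; no; does; contradiction)
open import Relation.Nullary.Decidable using (from-yes; decidable-stable; _→-dec_; ¬?)

-- Precomposing the unique extension `c` with `f` gives a proper colouring that still agrees with
-- `c₀` on `S`, hence equals `c`; so `v` and `f v` share a colour.
sudoku-rigid : ∀ (G : Graph) {k S c₀} → IsSudokuColoring G k S c₀ →
  let open Graph G in
  (f : Vertex → Vertex) → (∀ {u v} → Adj u v → Adj (f u) (f v)) →
  (∀ {v} → v ∈ S → f v ≡ v) → ∀ v → ¬ Adj v (f v)
sudoku-rigid G (_ , c , (proper , extends) , unique) f f-hom f-fixes v v~fv =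
  proper v~fv (unique {c ∘ f} (proper ∘ f-hom , agrees) v)
  where
  agrees : (c ∘ f ∘ proj₁) ≗ _
  agrees (u , u∈S) = trans (cong c (f-fixes u∈S)) (extends (u , u∈S))

swap : Fin 3 → Fin 3
swap 0F = 0F
swap 1F = 2F
swap 2F = 1F

swap-involutive : ∀ a → swap (swap a) ≡ a
swap-involutive 0F = refl
swap-involutive 1F = refl
swap-involutive 2F = refl

swap-injective : Injective _≡_ _≡_ swap
swap-injective {a} {b} eq =
  trans (sym (swap-involutive a)) (trans (cong swap eq) (swap-involutive b))

third-unique : ∀ (a b x y : Fin 3) → a ≢ b → x ≢ a → x ≢ b → y ≢ a → y ≢ b → x ≡ y
third-unique = from-yes (all? {3} λ a → all? {3} λ b → all? {3} λ x → all? {3} λ y →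
  ¬? (a ≟ b) →-dec ¬? (x ≟ a) →-dec ¬? (x ≟ b) →-dec
  ¬? (y ≟ a) →-dec ¬? (y ≟ b) →-dec (x ≟ y))

module _ {m : ℕ} where

  glue-elim : (P : Fin (suc (m * 2)) → Set) →
    P zero → (∀ t a → P (glue m t (suc a))) → ∀ v → P v
  glue-elim P centre outer zero    = centre
  glue-elim P centre outer (suc v) =
    subst (P ∘ suc) (combine-remQuot {m} 2 v) (uncurry outer (remQuot {m} 2 v))

  -- The map induced on the glued vertices by the maps f t on the triangles,
  -- all of which must send the corner 0 to x.
  unglue : {A : Set} → A → (Fin m → Fin 3 → A) → Fin (suc (m * 2)) → A
  unglue x f zero    = x
  unglue x f (suc v) = uncurry (λ t a → f t (suc a)) (remQuot {m} 2 v)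

  unglue-glue : ∀ {A : Set} {x : A} (f : Fin m → Fin 3 → A) → (∀ t → f t zero ≡ x) →
    ∀ t a → unglue x f (glue m t a) ≡ f t a
  unglue-glue f f-zero t zero    = sym (f-zero t)
  unglue-glue f f-zero t (suc a) =
    cong (uncurry λ t a → f t (suc a)) (remQuot-combine {m} t a)

  glue-adj : ∀ t {a b} → a ≢ b → FriendshipAdj m (glue m t a) (glue m t b)
  glue-adj t {a} {b} a≢b = t , a , b , a≢b , refl , refl

  friendship-connected : Connected (friendship m)
  friendship-connected u v = toCentre u ◅◅ reverse (Graph.symm (friendship m)) (toCentre v)
    where
    toCentre : ∀ v → Star (FriendshipAdj m) v zero
    toCentre = glue-elim (λ v → Star (FriendshipAdj m) v zero) ε
      λ t a → glue-adj t {suc a} {zero} (λ ()) ◅ ε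

  -- Every edge lies within a single triangle, so distinct colours inside each triangle suffice.
  unglue-proper : ∀ {k} {x : Fin k} (f : Fin m → Fin 3 → Fin k) → (∀ t → f t zero ≡ x) →
    (∀ t → Injective _≡_ _≡_ (f t)) → Proper (FriendshipAdj m) (unglue x f)
  unglue-proper f f-zero f-inj (t , a , b , a≢b , refl , refl) eq = a≢b (f-inj t
    (trans (sym (unglue-glue f f-zero t a)) (trans eq (unglue-glue f f-zero t b))))

  proper⇒3≤ : ∀ {k} → Fin m → (c : Fin (suc (m * 2)) → Fin k) →
    Proper (FriendshipAdj m) c → 3 ≤ k
  proper⇒3≤ t c proper = injective⇒≤ {f = c ∘ glue m t} λ {a} {b} eq →
    decidable-stable (a ≟ b) λ a≢b → proper (glue-adj t a≢b) eq

  swapAt : Fin m → Fin m → Fin 3 → Fin 3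
  swapAt t s = if does (s ≟ t) then swap else id

  swapAt-injective : ∀ t s → Injective _≡_ _≡_ (swapAt t s)
  swapAt-injective t s with s ≟ t
  ... | yes _ = swap-injective
  ... | no  _ = id

  swapAt-zero : ∀ t s → swapAt t s zero ≡ zero
  swapAt-zero t s with s ≟ t
  ... | yes _ = refl
  ... | no  _ = refl

  swapAt-self : ∀ t a → swapAt t t a ≡ swap a
  swapAt-self t a with t ≟ t
  ... | yes _   = refl
  ... | no  t≢t = contradiction refl t≢t

  exchange : Fin m → Fin (suc (m * 2)) → Fin (suc (m * 2))
  exchange t = unglue zero λ s a → glue m s (swapAt t s a)

  exchange-glue : ∀ t s a → exchange t (glue m s a) ≡ glue m s (swapAt t s a)
  exchange-glue t = unglue-glue (λ s a → glue m s (swapAt t s a))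
    λ s → cong (glue m s) (swapAt-zero t s)

  exchange-hom : ∀ t {u v} →
    FriendshipAdj m u v → FriendshipAdj m (exchange t u) (exchange t v)
  exchange-hom t (s , a , b , a≢b , refl , refl) =
    s , swapAt t s a , swapAt t s b , a≢b ∘ swapAt-injective t s ,
    exchange-glue t s a , exchange-glue t s b

  exchange-moves : ∀ t → FriendshipAdj m (glue m t 1F) (exchange t (glue m t 1F))
  exchange-moves t = t , 1F , 2F , (λ ()) , refl ,
    trans (exchange-glue t t 1F) (cong (glue m t) (swapAt-self t 1F))

  -- The centre is fixed by every exchange, so `S` may contain it.
  exchange-fixes : ∀ t {S} → (∀ a → ¬ glue m t (suc a) ∈ S) →
    ∀ {v} → v ∈ S → exchange t v ≡ v
  exchange-fixes t {S} misses {v} = glue-elim (λ v → v ∈ S → exchange t v ≡ v)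
    (λ _ → refl) (λ s a s∈S → trans (exchange-glue t s (suc a)) (fixes s a s∈S)) v
    where
    fixes : ∀ s a → glue m s (suc a) ∈ S → glue m s (swapAt t s (suc a)) ≡ glue m s (suc a)
    fixes s a s∈S with s ≟ t
    ... | yes refl = contradiction s∈S (misses a)
    ... | no  _    = refl

  sudoku-meets : ∀ {k S} → AdmitsSudokuColoring (friendship m) k S →
    ∀ t → ∃[ a ] glue m t (suc a) ∈ S
  sudoku-meets {S = S} (_ , sudoku) t with glue m t 1F ∈? S | glue m t 2F ∈? S
  ... | yes p | _     = 0F , p
  ... | no  _ | yes q = 1F , q
  ... | no ¬p | no ¬q = contradiction (exchange-moves t)
    (sudoku-rigid (friendship m) sudoku (exchange t) (exchange-hom t)
      (exchange-fixes t λ { 0F → ¬p ; 1F → ¬q }) (glue m t 1F))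

-- As `combine t a` has index `2t + a`, consecutive pairs of entries belong to the successive
-- triangles; the induction peels off one pair, which contributes at least one element.
meets⇒≤∣∣ : ∀ {m} (S : Subset (m * 2)) → (∀ t → ∃[ a ] combine {m} t a ∈ S) → m ≤ ∣ S ∣
meets⇒≤∣∣ {zero}  S           meets = z≤n
meets⇒≤∣∣ {suc m} (x ∷ y ∷ S) meets
  with meets zero
     | meets⇒≤∣∣ S (λ t → let a , p = meets (suc t) in a , drop-there (drop-there p))
meets⇒≤∣∣ (inside  ∷ inside  ∷ S) meets | _ | le = s≤s (≤-trans le (n≤1+n _))
meets⇒≤∣∣ (inside  ∷ outside ∷ S) meets | _ | le = s≤s le
meets⇒≤∣∣ (outside ∷ inside  ∷ S) meets | _ | le = s≤s le
meets⇒≤∣∣ (outside ∷ outside ∷ S) meets | 0F , () | le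
meets⇒≤∣∣ (outside ∷ outside ∷ S) meets | 1F , there () | le

sudoku⇒≤∣∣ : ∀ {m k S} → AdmitsSudokuColoring (friendship m) k S → m ≤ ∣ S ∣
-- The head `x` is the entry of the centre; dropping it leaves the outer vertices.
sudoku⇒≤∣∣ {S = x ∷ S} admits
  with meets⇒≤∣∣ S (λ t → let a , p = sudoku-meets admits t in a , drop-there p)
sudoku⇒≤∣∣ {S = inside  ∷ S} admits | le = ≤-trans le (n≤1+n _)
sudoku⇒≤∣∣ {S = outside ∷ S} admits | le = le

-- Only outer vertices are indexed here, so entry `combine t 0F` stands for the vertex
-- `glue m t 1F`.
firsts : ∀ m → Subset (m * 2)
firsts m = concat (replicate m (inside ∷ outside ∷ []))

∣firsts∣ : ∀ m → ∣ firsts m ∣ ≡ m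
∣firsts∣ zero    = refl
∣firsts∣ (suc m) = cong suc (∣firsts∣ m)

combine-∈-firsts : ∀ {m} (t : Fin m) → combine t 0F ∈ firsts m
combine-∈-firsts zero    = here
combine-∈-firsts (suc t) = there (there (combine-∈-firsts t))

-- The outer vertices get colours 1, 2 in triangle 0 and 2, 1 in all others, so
-- that both colours occur on firsts as soon as there are two triangles.
triangleColour : ∀ {m} → Fin m → Fin 3 → Fin 3
triangleColour zero    = id
triangleColour (suc _) = swap

triangleColour-zero : ∀ {m} (t : Fin m) → triangleColour t zero ≡ zero
triangleColour-zero zero    = refl
triangleColour-zero (suc _) = refl

triangleColour-injective : ∀ {m} (t : Fin m) → Injective _≡_ _≡_ (triangleColour t)
triangleColour-injective zero    = id
triangleColour-injective (suc _) = swap-injective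

colouring : ∀ m → Fin (suc (m * 2)) → Fin 3
colouring m = unglue {m} zero triangleColour

colouring-proper : ∀ m → Proper (FriendshipAdj m) (colouring m)
colouring-proper m = unglue-proper triangleColour triangleColour-zero triangleColour-injective

friendship-chromatic : ∀ n → IsChromaticNumber (friendship (suc n)) 3
friendship-chromatic n =
  (colouring (suc n) , colouring-proper (suc n)) ,
  λ (c , proper) → proper⇒3≤ {suc n} zero c proper

-- The centre sees two different colours, which leaves it one choice; the last corner of each
-- triangle then sees the centre and the prescribed corner.
firsts-determine : ∀ {n} (c d : Fin (suc (suc (suc n) * 2)) → Fin 3) →
  let m = suc (suc n) in
  Proper (FriendshipAdj m) c → Proper (FriendshipAdj m) d →
  c (glue m 0F 1F) ≢ c (glue m 1F 1F) →
  (∀ t → c (glue m t 1F) ≡ d (glue m t 1F)) → c ≗ d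
firsts-determine {n} c d c-proper d-proper distinct agree =
  glue-elim (λ v → c v ≡ d v) centre outer
  where
  m = suc (suc n)

  -- Both colourings are measured against the colours of `c`, because `third-unique` needs the same
  -- two forbidden colours for each.
  off : ∀ e → Proper (FriendshipAdj m) e → (∀ t → c (glue m t 1F) ≡ e (glue m t 1F)) →
    ∀ t {a} → a ≢ 1F → e (glue m t a) ≢ c (glue m t 1F)
  off e e-proper c≡e t a≢1 eq = e-proper (glue-adj t a≢1) (trans eq (c≡e t))

  c-off : ∀ t {a} → a ≢ 1F → c (glue m t a) ≢ c (glue m t 1F)
  c-off = off c c-proper λ _ → refl

  d-off : ∀ t {a} → a ≢ 1F → d (glue m t a) ≢ c (glue m t 1F)
  d-off = off d d-proper agree

  centre : c zero ≡ d zero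
  centre = third-unique _ _ _ _ distinct
    (c-off 0F {0F} λ ()) (c-off 1F {0F} λ ()) (d-off 0F {0F} λ ()) (d-off 1F {0F} λ ())

  outer : ∀ t a → c (glue m t (suc a)) ≡ d (glue m t (suc a))
  outer t 0F = agree t
  outer t 1F = third-unique _ _ _ _ (c-off t {0F} λ ())
    (c-proper (glue-adj t {2F} {0F} λ ())) (c-off t {2F} λ ())
    -- The forbidden colour is `c zero`, which `centre` identifies with `d zero`.
    (λ eq → d-proper (glue-adj t {2F} {0F} λ ()) (trans eq centre)) (d-off t {2F} λ ())

firsts-sudoku : ∀ n → let m = suc (suc n) in
  AdmitsSudokuColoring (friendship m) 3 (outside ∷ firsts m)
firsts-sudoku n = c ∘ proj₁ , (λ {_} {_} → c-proper) , c ,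
  ((λ {_} {_} → c-proper) , λ _ → refl) ,
  -- The empty pattern refutes `1F ≡ 2F`: triangle 1 is coloured by `swap`, triangle 0 by `id`.
  λ {d} (d-proper , d-agrees) → firsts-determine c d c-proper d-proper (λ ())
    λ t → sym (d-agrees (glue m t 1F , there (combine-∈-firsts t)))
  where
  m = suc (suc n)
  c = colouring m

  c-proper : Proper (FriendshipAdj m) c
  c-proper = colouring-proper m

corollary3p7 : (m : ℕ) → 2 ≤ m → IsSudokuNumber (friendship m) m
corollary3p7 (suc (suc n)) (s≤s (s≤s _)) = record
  { connected = friendship-connected
  ; k         = 3
  ; chromatic = friendship-chromatic (suc n)
  ; 2≤k       = s≤s (s≤s z≤n)
  ; least     =
      (outside ∷ firsts m , ∣firsts∣ m , firsts-sudoku n) ,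
      λ { (S , refl , admits) → sudoku⇒≤∣∣ admits }
  }
  where m = suc (suc n)
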